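{- Let $\{\{X_s:s\in\omega^{n+1}\}:n\in\omega\}$ be a family such that for every $n\in\omega$, $\{X_s:s\in\omega^{n+1}\}$ is a partition of $\omega$ into infinite sets, and such that $\bigcap_{i\in F}X_{s_i}$ is infinite for every finite $F\subseteq\omega$ and every choice of $s_i\in\omega^{i+1}$, $i\in F$. Let $\mathrm{Fin}'_\omega$ be the ideal on $\omega$ defined from this family as in the context. Then $\mathrm{Fin}_\omega\not\sqsubseteq\mathrm{Fin}'_\omega$, i.e., there is no bijection $f:\omega\to\sum_{i>0}\omega^i$ such that $f^{ -1}[A]\in\mathrm{Fin}'_\omega$ for every $A\in\mathrm{Fin}_\omega$.
   Context: An ideal on a countably infinite set $X$ is a family of subsets of $X$ closed under subsets and finite unions, not containing $X$ and containing all finite subsets of $X$; for an ideal $\mathcal{I}$ on $X$, $\mathcal{I}^\star=\{X\setminus A:A\in\mathcal{I}\}$. $\mathrm{Fin}$ is the ideal of finite subsets of $\omega$. For $n\ge1$ the ideal $\mathrm{Fin}^n$ on $\omega^n$ is defined by $\mathrm{Fin}^1=\mathrm{Fin}$ and: $A\subseteq\omega^{n+1}$ is in $\mathrm{Fin}^{n+1}$ iff $\{i\in\omega:\{x\in\omega^n:(i,x)\in A\}\notin\mathrm{Fin}^n\}$ is finite. For $n\in\omega$, $\mathrm{Fin}^{n+2}(\{X_s:s\in\omega^{n+1}\})$ is the family of all $A\subseteq\omega$ with $\{s\in\omega^{n+1}:A\cap X_s\text{ infinite}\}\in\mathrm{Fin}^{n+1}$; $\mathrm{Fin}'_\omega$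 is the ideal on $\omega$ generated by $\bigcup_{n\in\omega}\mathrm{Fin}^{n+2}(\{X_s:s\in\omega^{n+1}\})$ (sets contained in finite unions of members). $\mathrm{Fin}_\omega$ is the ideal on $\sum_{n\ge1}\omega^n=\{(n,x):n\ge1,x\in\omega^n\}$ defined as follows: for $1\le i\le j$ let $\pi_{i,j}:\omega^j\to\omega^i$, $\pi_{i,j}(x_0,\dots,x_{j-1})=(x_{j-i},\dots,x_{j-1})$; then $M\in\mathrm{Fin}_\omega$ iff there are $i\ge1$ and $P\subseteq\omega^i$ with $\omega^i\setminus P\in\mathrm{Fin}^i$ such that $M\cap\{(j,x):j\ge i,\ x\in\omega^j,\ \pi_{i,j}(x)\in P\}=\emptyset$. For ideals $\mathcal{I},\mathcal{J}$, $\mathcal{I}\sqsubseteq\mathcal{J}$ means there is a bijection $f:\mathrm{dom}(\mathcal{J})\to\mathrm{dom}(\mathcal{I})$ with $f^{ -1}[A]\in\mathcal{J}$ for all $A\in\mathcal{I}$. -}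

module Defs where

open import Data.Nat using (ℕ; zero; suc; _<_; _≤_; _∸_; _+_)
open import Data.Nat.Properties using (m∸n+n≡m)
open import Data.Vec using (Vec; _∷_; drop)
open import Data.Fin using (Fin)
open import Data.List using (List)
open import Data.List.Relation.Unary.All using (All)
open import Data.Product using (Σ; ∃; _×_; _,_)
open import Relation.Nullary using (¬_)
open import Relation.Binary.PropositionalEquality using (_≡_; subst)
open import Function.Bundles using (_⤖_; Bijection)

Subset : Set → Set₁
Subset A = A → Set

Finiteℕ : Subset ℕ → Set
Finiteℕ A = ∃ λ k → ∀ m → A m → m < k

Infiniteℕ : Subset ℕ → Set
Infiniteℕ A = ¬ Finiteℕ A

-- Fin^(n+1), an ideal on ω^(n+1) = Vec ℕ (suc n)  (ω is identified with ω^1).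
FinPow : (n : ℕ) → Subset (Vec ℕ (suc n)) → Set
FinPow zero    A = Finiteℕ (λ i → A (i ∷ Data.Vec.[]))
FinPow (suc n) A = Finiteℕ (λ i → ¬ FinPow n (λ x → A (i ∷ x)))

Family : Set₁
Family = (n : ℕ) → Vec ℕ (suc n) → Subset ℕ

FinX : Family → (n : ℕ) → Subset ℕ → Set
FinX X n A = FinPow n (λ s → Infiniteℕ (λ m → A m × X n s m))

Fin'ω : Family → Subset ℕ → Set₁
Fin'ω X A =
  Σ ℕ λ k → Σ (Fin k → ℕ) λ ns → Σ (Fin k → Subset ℕ) λ Bs →
    (∀ j → FinX X (ns j) (Bs j)) × (∀ m → A m → ∃ λ j → Bs j m)

-- The domain Σ_{n≥1} ω^n ; the pair (b , x) stands for (b+1 , x) with x ∈ ω^(b+1).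
SumDom : Set
SumDom = Σ ℕ λ b → Vec ℕ (suc b)

suffix : ∀ {A : Set} {j} (i : ℕ) → i ≤ j → Vec A j → Vec A i
suffix {j = j} i p xs = drop (j ∸ i) (subst (Vec _) (Relation.Binary.PropositionalEquality.sym (m∸n+n≡m p)) xs)

-- Fin_ω on SumDom.  Here i = a+1 and j = b+1.
Finω : Subset SumDom → Set₁
Finω M =
  Σ ℕ λ a → Σ (Subset (Vec ℕ (suc a))) λ P →
    FinPow a (λ x → ¬ P x) ×
    (∀ b (x : Vec ℕ (suc b)) (a≤b : a ≤ b) → M (b , x) → ¬ P (suffix (suc a) (Data.Nat.s≤s a≤b) x))

IsPartitionFamily : Family → Set
IsPartitionFamily X =
  (∀ n m → ∃ λ s → X n s m) ×
  (∀ n s t m → X n s m → X n t m → s ≡ t) ×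
  (∀ n s → Infiniteℕ (X n s))

IndependentFamily : Family → Set
IndependentFamily X =
  ∀ (F : List ℕ) (σ : (i : ℕ) → Vec ℕ (suc i)) →
    Infiniteℕ (λ m → All (λ i → X i (σ i) m) F)

{-# OPTIONS --safe #-}
module Submission where

-- The sets W_s = X_{s₀} ∩ … ∩ X_{sₙ} form a decreasing tree of infinite sets, and every A ∈ Fin'_ω is
-- null in it: for some depth d, A ∩ W_s is finite for Fin^d-almost all s. Suppose that f pulls back
-- Fin_ω into the null sets, and let y a m be the (a+1)-st coordinate from the end of f m.
-- A transversal, meeting every W_s on which y 1 is unbounded in an infinite set, can be chosen in
-- f⁻¹[Fin²]. It is null, so y 1 is bounded on almost all W_s with s of a certain length d. Such a W_s is
-- itself in f⁻¹[Fin²], but certainly not null in the tree above s. These W_s are glued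
-- one coordinate of s at a time, each step costing one more coordinate y a, into a single set of
-- f⁻¹[Fin^(d+2)] which is not null, a contradiction.
--
-- Everything is proved up to double negation. Choices are avoided by defining all sets
-- explicitly from the tree.

open import Defs
open import Data.Empty using (⊥; ⊥-elim)
open import Data.Fin using (Fin; toℕ; fromℕ<) renaming (zero to fzero; suc to fsuc)
open import Data.Fin.Properties using (toℕ<n; toℕ-fromℕ<)
open import Data.List as List using (List; []; _∷_; _++_)
open import Data.List.Properties using (drop-drop)
open import Data.List.Relation.Unary.All as All using (All; []; _∷_)
open import Data.Nat using (ℕ; zero; suc; _+_; _∸_; _⊔_; _≤_; _<_; s≤s; s≤s⁻¹; _≟_; _<?_)
open import Data.Nat.Induction using (<-rec)
open import Data.Nat.Properties
open import Data.Product using (Σ; ∃; _×_; _,_; proj₁; proj₂)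
open import Data.Sum using (_⊎_; inj₁; inj₂)
open import Data.Unit using (⊤; tt)
open import Data.Vec as Vec using (Vec; []; _∷_; toList)
open import Data.Vec.Properties using (cast-is-id; toList-injective)
open import Function.Base using (_∘_; id)
open import Function.Bundles using (_⤖_; Bijection)
open import Level using (Level)
open import Relation.Binary.Definitions using (tri<; tri≈; tri>)
open import Relation.Binary.PropositionalEquality using (_≡_; refl; sym; trans; cong; subst; module ≡-Reasoning)
open import Relation.Nullary using (¬_; Dec; yes; no)
open import Relation.Nullary.Decidable using (¬¬-excluded-middle; decidable-stable)

-- Classical reasoning under double negation

private
  variable
    ℓ ℓ′ : Level
    A : Set ℓ
    B : Set ℓ′

infixl 1 _>>=_

_>>=_ : ¬ ¬ A → (A → ¬ ¬ B) → ¬ ¬ B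
(¬¬a >>= g) ¬b = ¬¬a λ x → g x ¬b

return : A → ¬ ¬ A
return x ¬x = ¬x x

lem : (A : Set ℓ) → ¬ ¬ Dec A
lem A = ¬¬-excluded-middle

-- Inequalities are decidable, so a bound in `Finiteℕ` may be proved classically.
<-stable : ∀ {m n} → ¬ ¬ (m < n) → m < n
<-stable = decidable-stable (_ <? _)

¬¬-least : (P : ℕ → Set) → ∀ m → P m → ¬ ¬ (∃ λ n → P n × (∀ k → k < n → ¬ P k))
¬¬-least P m p none = <-rec (λ n → ¬ P n) (λ n below q → none (n , q , λ k k<n → below k<n)) m p

bounded-below : (h : ℕ → ℕ) → ∀ n → ∃ λ l → ∀ m → m < n → h m ≤ l
bounded-below h zero    = 0 , λ _ ()
bounded-below h (suc n) with bounded-below h n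
... | l , below = h n ⊔ l , bound
  where
  bound : ∀ m → m < suc n → h m ≤ h n ⊔ l
  bound m m<1+n with m≤n⇒m<n∨m≡n (s≤s⁻¹ m<1+n)
  ... | inj₁ m<n  = ≤-trans (below m m<n) (m≤n⊔m (h n) l)
  ... | inj₂ refl = m≤m⊔n (h n) l

-- Ideals, and the ideals Fin^n

-- Monotonicity is taken up to double negation, so that membership may be decided classically.
record Ideal {A : Set} (I : Subset A → Set) : Set₁ where
  field
    empty : I (λ _ → ⊥)
    mono  : ∀ {P Q : Subset A} → (∀ x → P x → ¬ ¬ Q x) → I Q → I P
    union : ∀ {P Q : Subset A} → I P → I Q → I (λ x → P x ⊎ Q x)

  ⋃-Fin : ∀ n (P : Fin n → Subset A) → (∀ i → ¬ ¬ I (P i)) → ¬ ¬ I (λ x → ∃ λ i → P i x)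
  ⋃-Fin zero    P each = return (mono (λ _ ()) empty)
  ⋃-Fin (suc n) P each =
    each fzero >>= λ here → ⋃-Fin n (P ∘ fsuc) (each ∘ fsuc) >>= λ there →
    return (mono (λ { _ (fzero , p)  → return (inj₁ p)
                    ; _ (fsuc i , p) → return (inj₂ (i , p)) })
                 (union here there))

  ⋃-< : ∀ n (P : ℕ → Subset A) → (∀ i → i < n → ¬ ¬ I (P i)) →
        ¬ ¬ I (λ x → ∃ λ i → i < n × P i x)
  ⋃-< n P each =
    ⋃-Fin n (P ∘ toℕ) (λ i → each (toℕ i) (toℕ<n i)) >>= λ all →
    return (mono (λ { x (i , i<n , p) →
                      return (fromℕ< i<n , subst (λ j → P j x) (sym (toℕ-fromℕ< i<n)) p) })
                 all)

open Ideal

Finiteℕ-ideal : Ideal Finiteℕ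
Finiteℕ-ideal .empty = 0 , λ _ ()
Finiteℕ-ideal .mono P⊆Q (k , below) = k , λ m p → <-stable (P⊆Q m p >>= λ q → return (below m q))
Finiteℕ-ideal .union (k , below) (l , below′) = k ⊔ l , λ
  { m (inj₁ p) → <-≤-trans (below m p) (m≤m⊔n k l)
  ; m (inj₂ q) → <-≤-trans (below′ m q) (m≤n⊔m k l) }

FinPow-suc : ∀ {n P} K → (∀ i → K ≤ i → ¬ ¬ FinPow n (λ v → P (i ∷ v))) → FinPow (suc n) P
FinPow-suc K large = K , λ i ¬fin → ≰⇒> λ K≤i → large i K≤i ¬fin

FinPow-large : ∀ {n P} (fin : FinPow (suc n) P) → ∀ i → proj₁ fin ≤ i → ¬ ¬ FinPow n (λ v → P (i ∷ v))
FinPow-large (K , below) i K≤i ¬fin = <⇒≱ (below i ¬fin) K≤i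

FinPow-ideal : ∀ n → Ideal (FinPow n)
FinPow-ideal zero .empty = empty Finiteℕ-ideal
FinPow-ideal zero .mono P⊆Q = mono Finiteℕ-ideal (λ i → P⊆Q (i ∷ []))
FinPow-ideal zero .union = union Finiteℕ-ideal
FinPow-ideal (suc n) .empty = FinPow-suc {n} {λ _ → ⊥} 0 λ _ _ → return (empty (FinPow-ideal n))
FinPow-ideal (suc n) .mono {P} {Q} P⊆Q fin = FinPow-suc {n} {P} (proj₁ fin) λ i K≤i →
  FinPow-large {n} {Q} fin i K≤i >>= λ s → return (mono (FinPow-ideal n) (λ v → P⊆Q (i ∷ v)) s)
FinPow-ideal (suc n) .union {P} {Q} finP finQ =
  FinPow-suc {n} {λ v → P v ⊎ Q v} (proj₁ finP ⊔ proj₁ finQ) λ i K≤i →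
  FinPow-large {n} {P} finP i (m⊔n≤o⇒m≤o _ _ K≤i) >>= λ s →
  FinPow-large {n} {Q} finQ i (m⊔n≤o⇒n≤o _ _ K≤i) >>= λ t →
  return (union (FinPow-ideal n) s t)

-- Exceeds every entry and is at least the length, so only finitely many sequences have weight below
-- a given bound.
weight : List ℕ → ℕ
weight []      = 0
weight (i ∷ s) = suc (i ⊔ weight s)

⋃-weight< : ∀ {A} {I : Subset A → Set} → Ideal I → ∀ n (P : List ℕ → Subset A) →
            (∀ s → ¬ ¬ I (P s)) → ¬ ¬ I (λ x → ∃ λ s → weight s < n × P s x)
⋃-weight< ideal zero    P each = return (mono ideal (λ { _ (_ , () , _) }) (empty ideal))
⋃-weight< ideal (suc n) P each =
  each [] >>= λ nil →
  ⋃-< ideal n (λ i x → ∃ λ s → weight s < n × P (i ∷ s) x)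
    (λ i _ → ⋃-weight< ideal n (λ s → P (i ∷ s)) (λ s → each (i ∷ s))) >>= λ cons →
  return (mono ideal
    (λ { _ ([] , _ , p) → return (inj₁ p)
       ; _ (i ∷ s , s≤s w<n , p) →
           return (inj₂ (i , ≤-<-trans (m≤m⊔n i (weight s)) w<n
                           , s , ≤-<-trans (m≤n⊔m i (weight s)) w<n , p)) })
    (union ideal nil cons))

-- Trees of sets

Tree : Set₁
Tree = List ℕ → Subset ℕ

_↓_ : Tree → ℕ → Tree
(T ↓ i) s = T (i ∷ s)

Decreasing : Tree → Set
Decreasing T = ∀ s i m → T (s ++ i ∷ []) m → T s m

-- The quantifier dual to Fin^d, with d = 0 testing the root alone.
AlmostAll : ℕ → Tree → (Subset ℕ → Set) → Set
AlmostAll zero    T R = R (T [])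
AlmostAll (suc d) T R = ∃ λ K → ∀ i → K ≤ i → ¬ ¬ AlmostAll d (T ↓ i) R

AlmostAll-map : ∀ {R S : Subset ℕ → Set} d T → (∀ s → R (T s) → S (T s)) → AlmostAll d T R → AlmostAll d T S
AlmostAll-map zero    T imp r = imp [] r
AlmostAll-map (suc d) T imp (K , large) = K , λ i K≤i →
  large i K≤i >>= λ r → return (AlmostAll-map d (T ↓ i) (λ s → imp (i ∷ s)) r)

NullAt : ℕ → Tree → Subset ℕ → Set
NullAt d T A = AlmostAll d T (λ S → Finiteℕ (λ m → A m × S m))

NullAt-ideal : ∀ d T → Ideal (NullAt d T)
NullAt-ideal zero T .empty = 0 , λ { _ (() , _) }
NullAt-ideal zero T .mono P⊆Q = mono Finiteℕ-ideal λ { m (p , t) → P⊆Q m p >>= λ q → return (q , t) }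
NullAt-ideal zero T .union finP finQ =
  mono Finiteℕ-ideal (λ { m (inj₁ p , t) → return (inj₁ (p , t)) ; m (inj₂ q , t) → return (inj₂ (q , t)) })
       (union Finiteℕ-ideal finP finQ)
NullAt-ideal (suc d) T .empty = 0 , λ i _ → return (empty (NullAt-ideal d (T ↓ i)))
NullAt-ideal (suc d) T .mono P⊆Q (K , large) = K , λ i K≤i →
  large i K≤i >>= λ q → return (mono (NullAt-ideal d (T ↓ i)) P⊆Q q)
NullAt-ideal (suc d) T .union (K , largeP) (L , largeQ) = K ⊔ L , λ i K⊔L≤i →
  largeP i (m⊔n≤o⇒m≤o _ _ K⊔L≤i) >>= λ p → largeQ i (m⊔n≤o⇒n≤o _ _ K⊔L≤i) >>= λ q →
  return (union (NullAt-ideal d (T ↓ i)) p q)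

NullAt-⊆ : ∀ {A} d {T U : Tree} → (∀ s m → T s m → U s m) → NullAt d U A → NullAt d T A
NullAt-⊆ zero    T⊆U fin = mono Finiteℕ-ideal (λ { m (x , t) → return (x , T⊆U [] m t) }) fin
NullAt-⊆ (suc d) T⊆U (K , large) = K , λ i K≤i →
  large i K≤i >>= λ n → return (NullAt-⊆ d (λ s → T⊆U (i ∷ s)) n)

-- Children lie inside their parent, so a finite trace passes on to all of them.
NullAt-suc : ∀ {A} d {T} → Decreasing T → NullAt d T A → NullAt (suc d) T A
NullAt-suc zero dec fin = 0 , λ i _ →
  return (mono Finiteℕ-ideal (λ { m (x , t) → return (x , dec [] i m t) }) fin)
NullAt-suc (suc d) dec (K , large) = K , λ i K≤i →
  large i K≤i >>= λ n → return (NullAt-suc d (λ s → dec (i ∷ s)) n)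

NullAt-+ : ∀ {A} d e {T} → Decreasing T → NullAt d T A → NullAt (e + d) T A
NullAt-+ d zero    dec n = n
NullAt-+ d (suc e) dec n = NullAt-suc (e + d) dec (NullAt-+ d e dec n)

Null : Tree → Subset ℕ → Set
Null T A = ∃ λ d → NullAt d T A

Null-ideal : ∀ {T} → Decreasing T → Ideal (Null T)
Null-ideal {T} dec .empty = 0 , empty (NullAt-ideal 0 T)
Null-ideal {T} dec .mono P⊆Q (d , n) = d , mono (NullAt-ideal d T) P⊆Q n
Null-ideal {T} dec .union {P} {Q} (d , p) (e , q) = e + d ,
  union (NullAt-ideal (e + d) T) (NullAt-+ d e dec p)
    (subst (λ k → NullAt k T Q) (+-comm d e) (NullAt-+ e d dec q))

Null-↓ : ∀ {T A} → Decreasing T → Null T A → ∃ λ K → ∀ i → K ≤ i → ¬ ¬ Null (T ↓ i) A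
-- Going one level deeper provides a threshold also when d = 0.
Null-↓ dec (d , n) with NullAt-suc d dec n
... | K , large = K , λ i K≤i → large i K≤i >>= λ n′ → return (d , n′)

-- Every node lies inside `A`; moving to the threshold child at each level ends at an infinite node
-- with finite trace on `A`.
root-positive : ∀ {A} d {T} → Decreasing T → (∀ s → Infiniteℕ (T s)) → (∀ m → T [] m → A m) →
                ¬ NullAt d T A
root-positive zero dec inf T⊆A fin =
  inf [] (mono Finiteℕ-ideal (λ m t → return (T⊆A m t , t)) fin)
root-positive (suc d) dec inf T⊆A (K , large) = large K ≤-refl
  (root-positive d (λ s → dec (K ∷ s)) (λ s → inf (K ∷ s)) (λ m t → T⊆A m (dec [] K m t)))

-- The tree of intersections of the X_s

Selection : Set
Selection = (i : ℕ) → Vec ℕ (suc i)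

update : Selection → ∀ n → Vec ℕ (suc n) → Selection
update σ n v i with i ≟ n
... | yes refl = v
... | no _     = σ i

update-≡ : ∀ σ n v → update σ n v n ≡ v
update-≡ σ n v with n ≟ n
... | yes refl = refl
... | no n≢n   = ⊥-elim (n≢n refl)

update-< : ∀ σ n v i → n < i → update σ n v i ≡ σ i
update-< σ n v i n<i with i ≟ n
... | yes refl = ⊥-elim (<-irrefl refl n<i)
... | no _     = refl

module _ (X : Family) where

  -- A sequence is read as consecutive blocks s₀ ∈ ω¹, s₁ ∈ ω², …; its set is the intersection of
  -- the X_{sₙ} over the complete blocks. The argument φ is X n applied to the part of block n read so far.
  blocks : ∀ n k → (Vec ℕ (suc k) → Subset ℕ) → Tree
  blocks n k       φ []      m = ⊤
  blocks n zero    φ (i ∷ s) m = φ (i ∷ []) m × blocks (suc n) (suc n) (X (suc n)) s m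
  blocks n (suc k) φ (i ∷ s) m = blocks n k (λ v → φ (i ∷ v)) s m

  blocks-decreasing : ∀ n k φ → Decreasing (blocks n k φ)
  blocks-decreasing n k       φ []      i m t = tt
  blocks-decreasing n zero    φ (j ∷ s) i m (x , t) = x , blocks-decreasing (suc n) (suc n) _ s i m t
  blocks-decreasing n (suc k) φ (j ∷ s) i m t = blocks-decreasing n k _ s i m t

  -- Later blocks only use indices above `n`, so `update` at `n` leaves their choices intact. `c`
  -- prepends the entries of block `n` already read.
  blocks-⊇ : ∀ s n k (c : Vec ℕ (suc k) → Vec ℕ (suc n)) →
             ∃ λ F → Σ Selection λ σ → All (n ≤_) F ×
               (∀ m → All (λ i → X i (σ i) m) F → blocks n k (λ v → X n (c v)) s m)
  blocks-⊇ [] n k c = [] , (λ i → Vec.replicate (suc i) 0) , [] , λ _ _ → tt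
  blocks-⊇ (i ∷ s) n (suc k) c = blocks-⊇ s n k (λ v → c (i ∷ v))
  blocks-⊇ (i ∷ s) n zero c with blocks-⊇ s (suc n) (suc n) id
  ... | F , σ , n<F , sub = n ∷ F , σ′ , ≤-refl ∷ All.map <⇒≤ n<F , λ
    { m (x ∷ xs) → subst (λ v → X n v m) (update-≡ σ n w) x
                 , sub m (All.zipWith (λ { {j} (n<j , y) → subst (λ v → X j v m) (update-< σ n w j n<j) y })
                                      (n<F , xs)) }
    where
    w  = c (i ∷ [])
    σ′ = update σ n w

  intersections : Tree
  intersections = blocks 0 0 (X 0)

  intersections-infinite : IndependentFamily X → ∀ s → Infiniteℕ (intersections s)
  intersections-infinite ind s fin with blocks-⊇ s 0 0 id
  ... | F , σ , _ , sub = ind F σ (mono Finiteℕ-ideal (λ m all → return (sub m all)) fin)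

  -- The recursions of `FinPow` and `NullAt` match entry by entry until the block is complete.
  block-null : ∀ {B} n k φ → FinPow k (λ v → Infiniteℕ (λ m → B m × φ v m)) →
               NullAt (suc k) (blocks n k φ) B
  block-null n zero φ (K , below) = K , λ i K≤i inf →
    <⇒≱ (below i (λ fin → inf (mono Finiteℕ-ideal (λ { m (x , y , _) → return (x , y) }) fin))) K≤i
  block-null {B} n (suc k) φ fin = proj₁ fin , λ i K≤i →
    FinPow-large {k} {λ v → Infiniteℕ (λ m → B m × φ v m)} fin i K≤i >>= λ f →
    return (block-null n k (λ v → φ (i ∷ v)) f)

  -- Whatever the entries of a block, the tree above them is contained in the tree starting with the
  -- next block.
  skip-block : ∀ {B} d n k φ → NullAt d (blocks (suc n) (suc n) (X (suc n))) B →
               NullAt (suc k + d) (blocks n k φ) B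
  skip-block d n zero    φ null = 0 , λ i _ → return (NullAt-⊆ d (λ s m → proj₂) null)
  skip-block d n (suc k) φ null = 0 , λ i _ → return (skip-block d n k (λ v → φ (i ∷ v)) null)

  skip-blocks : ∀ {B} d n → NullAt d (blocks n n (X n)) B → Null intersections B
  skip-blocks d zero    null = d , null
  skip-blocks d (suc n) null = skip-blocks (suc n + d) n (skip-block d n n (X n) null)

  FinX-null : ∀ {B} n → FinX X n B → Null intersections B
  FinX-null n fin = skip-blocks (suc n) n (block-null n n (X n) fin)

  Fin'ω-null : ∀ {A} → Fin'ω X A → ¬ ¬ Null intersections A
  Fin'ω-null (k , ns , Bs , fin , cover) =
    ⋃-Fin ideal k Bs (λ j → return (FinX-null (ns j) (fin j))) >>= λ null →
    return (mono ideal (λ m x → return (cover m x)) null)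
    where ideal = Null-ideal (blocks-decreasing 0 0 (X 0))

-- Coordinates counted from the end

toList-subst : ∀ {A : Set} {m n} (eq : m ≡ n) (xs : Vec A m) → toList (subst (Vec A) eq xs) ≡ toList xs
toList-subst refl xs = refl

toList-drop : ∀ {A : Set} m {n} (xs : Vec A (m + n)) → toList (Vec.drop m xs) ≡ List.drop m (toList xs)
toList-drop zero    xs       = refl
toList-drop (suc m) (x ∷ xs) = toList-drop m xs

-- Passing to lists removes the transport hidden in `suffix`.
toList-suffix : ∀ {A : Set} i {j} (i≤j : i ≤ j) (xs : Vec A j) →
                toList (suffix i i≤j xs) ≡ List.drop (j ∸ i) (toList xs)
toList-suffix i {j} i≤j xs =
  trans (toList-drop (j ∸ i) _) (cong (List.drop (j ∸ i)) (toList-subst (sym (m∸n+n≡m i≤j)) xs))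

toList-injective′ : ∀ {A : Set} {n} (xs ys : Vec A n) → toList xs ≡ toList ys → xs ≡ ys
toList-injective′ xs ys eq = trans (sym (cast-is-id refl xs)) (toList-injective refl xs ys eq)

headOr0 : List ℕ → ℕ
headOr0 []      = 0
headOr0 (k ∷ _) = k

-- The paper's x_{b-a} for x ∈ ω^{b+1}; when a > b it is x₀ instead.
coordinate : ℕ → SumDom → ℕ
coordinate a (b , x) = headOr0 (List.drop (b ∸ a) (toList x))

record Suffix (a : ℕ) (z : SumDom) (v : Vec ℕ (suc a)) : Set where
  constructor _,_
  field
    long-enough : a ≤ proj₁ z
    is-suffix   : suffix (suc a) (s≤s long-enough) (proj₂ z) ≡ v

Suffix-toList : ∀ {a z v} → Suffix a z v → List.drop (proj₁ z ∸ a) (toList (proj₂ z)) ≡ toList v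
Suffix-toList {a} {b , x} (a≤b , eq) = trans (sym (toList-suffix (suc a) (s≤s a≤b) x)) (cong toList eq)

Suffix-head : ∀ {a z k v} → Suffix a z (k ∷ v) → coordinate a z ≡ k
Suffix-head e = cong headOr0 (Suffix-toList e)

Suffix-tail : ∀ {a z k v} → Suffix (suc a) z (k ∷ v) → Suffix a z v
Suffix-tail {a} {b , x} {k} {v} e@(a<b , _) = <⇒≤ a<b , toList-injective′ _ v (begin
  toList (suffix (suc a) (s≤s (<⇒≤ a<b)) x)          ≡⟨ toList-suffix (suc a) (s≤s (<⇒≤ a<b)) x ⟩
  List.drop (b ∸ a) (toList x)                       ≡⟨ cong (λ n → List.drop n (toList x)) b∸a ⟩
  List.drop (b ∸ suc a + 1) (toList x)               ≡⟨ sym (drop-drop (b ∸ suc a) 1 (toList x)) ⟩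
  List.drop 1 (List.drop (b ∸ suc a) (toList x))     ≡⟨ cong (List.drop 1) (Suffix-toList e) ⟩
  toList v                                           ∎)
  where
  open ≡-Reasoning
  b∸a : b ∸ a ≡ b ∸ suc a + 1
  b∸a = trans (+-∸-assoc 1 a<b) (+-comm 1 (b ∸ suc a))

-- Sets whose image lies in Fin_ω

module _ (f : ℕ → SumDom) where

  y : ℕ → ℕ → ℕ
  y a m = coordinate a (f m)

  Fibre : ℕ → ℕ → Subset ℕ
  Fibre a k m = y a m ≡ k

  Image : ∀ a → Subset ℕ → Subset (Vec ℕ (suc a))
  Image a M v = ∃ λ m → M m × Suffix a (f m) v

  -- Membership of f[M] in Fin_ω with i = a + 1 as witness: the complement of `Image a M` is the
  -- largest possible P.
  Small : ℕ → Subset ℕ → Set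
  Small a M = FinPow a (Image a M)

  Small-ideal : ∀ a → Ideal (Small a)
  Small-ideal a .empty = mono (FinPow-ideal a) (λ { _ (_ , () , _) }) (empty (FinPow-ideal a))
  Small-ideal a .mono P⊆Q = mono (FinPow-ideal a) λ { v (m , p , e) → P⊆Q m p >>= λ q → return (m , q , e) }
  Small-ideal a .union P Q =
    mono (FinPow-ideal a)
      (λ { v (m , inj₁ p , e) → return (inj₁ (m , p , e)) ; v (m , inj₂ q , e) → return (inj₂ (m , q , e)) })
      (union (FinPow-ideal a) P Q)

  Small-suc : ∀ a {M} K → (∀ k → K ≤ k → ¬ ¬ Small a (λ m → M m × Fibre (suc a) k m)) → Small (suc a) M
  Small-suc a {M} K large = FinPow-suc {a} {Image (suc a) M} K λ k K≤k → large k K≤k >>= λ s →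
    return (mono (FinPow-ideal a)
      (λ { v (m , x , e) → return (m , (x , Suffix-head e) , Suffix-tail e) }) s)

  Small⇒Finω : ∀ a {M} → Small a M → Finω (λ x → ∃ λ m → f m ≡ x × M m)
  Small⇒Finω a {M} small = a , (λ v → ¬ Image a M v) , mono (FinPow-ideal a) (λ _ → id) small ,
    λ { b x a≤b (m , eq , p) ¬im →
        ¬im (m , p , subst (λ z → Suffix a z (suffix (suc a) (s≤s a≤b) x)) (sym eq) (a≤b , refl)) }

  -- Transversals for the second to last coordinate

  Bounded : Subset ℕ → Set
  Bounded S = ∃ λ l → ∀ m → S m → y 1 m ≤ l

  FirstIn : Subset ℕ → Subset ℕ
  FirstIn S m = S m × (∀ m′ → m′ < m → ¬ (S m′ × y 1 m′ ≡ y 1 m))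

  -- Meets T s in an infinite set as soon as the second to last coordinate is unbounded on T s.
  transversal : Tree → Subset ℕ
  transversal T m = ∃ λ s → weight s ≤ y 1 m × FirstIn (T s) m

  -- A fibre of `y 1` has at most one least point in `S`, so at most one last coordinate occurs.
  FirstIn-small : ∀ S k → ¬ ¬ Small 0 (λ m → FirstIn S m × Fibre 1 k m)
  FirstIn-small S k = lem (∃ λ m → FirstIn S m × Fibre 1 k m) >>= λ
    { (no none) → return (mono (Small-ideal 0) (λ m p _ → none (m , p)) (empty (Small-ideal 0)))
    ; (yes (n , (n∈S , n-first) , refl)) → return (suc (y 0 n) , λ
        { z (m , ((m∈S , m-first) , eq) , e) → s≤s (≤-reflexive (trans (sym (Suffix-head e))
            (cong (y 0) (unique m n m∈S n∈S m-first n-first eq)))) }) }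
    where
    unique : ∀ m n → S m → S n → (∀ m′ → m′ < m → ¬ (S m′ × y 1 m′ ≡ y 1 m)) →
             (∀ m′ → m′ < n → ¬ (S m′ × y 1 m′ ≡ y 1 n)) → y 1 m ≡ y 1 n → m ≡ n
    unique m n m∈S n∈S m-first n-first eq with <-cmp m n
    ... | tri< m<n _ _ = ⊥-elim (n-first m m<n (m∈S , eq))
    ... | tri≈ _ m≡n _ = m≡n
    ... | tri> _ _ n<m = ⊥-elim (m-first n n<m (n∈S , sym eq))

  -- On the fibre `y 1 = k` only the finitely many `s` of weight at most `k` contribute.
  transversal-small : ∀ T → Small 1 (transversal T)
  transversal-small T = Small-suc 0 0 λ k _ →
    ⋃-weight< (Small-ideal 0) (suc k) (λ s m → FirstIn (T s) m × Fibre 1 k m) (λ s → FirstIn-small (T s) k)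
    >>= λ small → return (mono (Small-ideal 0)
      (λ { m ((s , w , first) , refl) → return (s , s≤s w , first , refl) }) small)

  -- If `y 1 m` exceeded both `weight s` and all values of `y 1` below `n`, the least point of `T s`
  -- with this value would lie in the transversal, hence below `n`.
  transversal-finite⇒Bounded : ∀ T s → Finiteℕ (λ m → transversal T m × T s m) → Bounded (T s)
  transversal-finite⇒Bounded T s (n , below) with bounded-below (y 1) n
  ... | l , small = weight s ⊔ l , λ m m∈T → ≮⇒≥ λ big →
    ¬¬-least (λ m′ → T s m′ × y 1 m′ ≡ y 1 m) m (m∈T , refl) λ
      { (p , (p∈T , eq) , first) →
        let big′ = subst (weight s ⊔ l <_) (sym eq) big
            p<n  = below p ((s , <⇒≤ (m⊔n<o⇒m<o _ _ big′) , p∈T ,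
                             λ { q q<p (q∈T , eq′) → first q q<p (q∈T , trans eq′ eq) }) , p∈T)
        in <⇒≱ (m⊔n<o⇒n<o _ _ big′) (small p p<n) }

  -- Diagonal sets

  NullFibre : ℕ → Tree → ℕ → Set
  NullFibre a T k = Null T (Fibre a k)

  -- Suppose all fibres y a = k are null in T. Then for each k only finitely many i satisfy the negated
  -- condition on i, so the fibre of the diagonal at k is a finite union of small sets; and the part of
  -- diagonal d (T ↓ i) that is left out lies in finitely many null fibres, k < i, hence is null in T ↓ i.
  -- Otherwise the diagonal contains the first fibre that is not null, and no later such fibre meets it.
  diagonal : ℕ → Tree → Subset ℕ
  diagonal zero    T m = T [] m × Bounded (T [])
  diagonal (suc d) T m =
    (NullFibre a T k → ∃ λ i → ¬ (k < i × NullFibre a (T ↓ i) k) × diagonal d (T ↓ i) m) ×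
    (¬ NullFibre a T k → ∀ k′ → k′ < k → ¬ ¬ NullFibre a T k′)
    where
    a = suc (suc d)
    k = y a m

  diagonal-small : ∀ d {T} → Decreasing T → ¬ ¬ Small (suc d) (diagonal d T)
  diagonal-small zero {T} dec = lem (Bounded (T [])) >>= λ
    { (no unbounded) → return (mono (Small-ideal 1) (λ m p _ → unbounded (proj₂ p)) (empty (Small-ideal 1)))
    ; (yes (l , bound)) → return (Small-suc 0 (suc l) λ k l<k →
        return (mono (Small-ideal 0) (λ { m ((t , _) , refl) _ → <⇒≱ l<k (bound m t) })
                     (empty (Small-ideal 0)))) }
  diagonal-small (suc d) {T} dec = lem (∃ λ k → ¬ NullFibre a T k) >>= λ
    { (no none) → return (Small-suc (suc d) 0 λ k _ → null-section k λ ¬null → none (k , ¬null))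
    -- Beyond `k₀` the non-null fibres miss the diagonal, since `k₀` precedes them.
    ; (yes (k₀ , ¬null₀)) → return (Small-suc (suc d) (suc k₀) λ k k₀<k → lem (NullFibre a T k) >>= λ
        { (yes null) → null-section k (return null)
        ; (no ¬null) → return (mono (Small-ideal (suc d))
            (λ { m ((_ , q) , refl) _ → q ¬null k₀ k₀<k ¬null₀ }) (empty (Small-ideal (suc d)))) }) }
    where
    a = suc (suc d)
    null-section : ∀ k → ¬ ¬ NullFibre a T k → ¬ ¬ Small (suc d) (λ m → diagonal (suc d) T m × Fibre a k m)
    null-section k ¬¬null = ¬¬null >>= λ null →
      let K , large = Null-↓ dec null in
      -- An index `i` from `suc k ⊔ K` on has `k < i` and a null fibre at `k` in `T ↓ i`, so the
      -- condition on `i` excludes it.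
      ⋃-< (Small-ideal (suc d)) (suc k ⊔ K) (λ i → diagonal d (T ↓ i))
        (λ i _ → diagonal-small d (λ s → dec (i ∷ s))) >>= λ small →
      return (mono (Small-ideal (suc d))
        (λ { m ((p , _) , refl) →
             let i , cond , q = p null
             in return (i , ≰⇒> (λ N≤i → large i (m⊔n≤o⇒n≤o (suc k) K N≤i) λ n →
                                  cond (m⊔n≤o⇒m≤o (suc k) K N≤i , n)) , q) })
        small)

  diagonal-positive : ∀ d {T} → Decreasing T → (∀ s → Infiniteℕ (T s)) →
                      AlmostAll d T Bounded → ¬ Null T (diagonal d T)
  diagonal-positive zero dec inf bdd (e , null) = root-positive e dec inf (λ m t → t , bdd) null
  diagonal-positive (suc d) {T} dec inf (K , large) null = lem (∃ λ k → ¬ NullFibre a T k) λ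
    { (yes (k , ¬null)) → ¬¬-least (λ k → ¬ NullFibre a T k) k ¬null λ
        { (k₀ , ¬null₀ , first) → ¬null₀ (mono (Null-ideal dec)
            (λ { m refl → return ((λ null₀ → ⊥-elim (¬null₀ null₀)) , λ _ → first) }) null) }
    ; (no none) →
        let L , large′ = Null-↓ dec null
            -- In this child the diagonal of `T` is null and `y 1` is bounded on almost all nodes.
            i = K ⊔ L
            ideal = Null-ideal (λ s → dec (i ∷ s))
        in large′ i (m≤n⊔m K L) λ null′ → large i (m≤m⊔n K L) λ bdd →
           ⋃-< ideal i (λ k m → NullFibre a (T ↓ i) k × Fibre a k m)
             (λ k _ → lem (NullFibre a (T ↓ i) k) >>= λ
               { (yes n) → return (mono ideal (λ m p → return (proj₂ p)) n)
               ; (no ¬n) → return (mono ideal (λ m p _ → ¬n (proj₁ p)) (empty ideal)) }) λ rest →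
           diagonal-positive d (λ s → dec (i ∷ s)) (λ s → inf (i ∷ s)) bdd
             -- A point of the child's diagonal lies in the diagonal of `T` if `i` meets the
             -- condition, and otherwise in one of the null fibres `k < i`.
             (mono ideal
               (λ m q → lem (y a m < i × NullFibre a (T ↓ i) (y a m)) >>= λ
                 { (yes (k<i , n)) → return (inj₂ (y a m , k<i , n , refl))
                 ; (no cond) → return (inj₁ ((λ _ → i , cond , q) , λ ¬n → ⊥-elim (none (y a m , ¬n)))) })
               (union ideal null′ rest)) }
    where
    a = suc (suc d)

  -- Small sets that are not null

  ¬Small⊆Null : ∀ {T} → Decreasing T → (∀ s → Infiniteℕ (T s)) → ¬ (∀ a M → Small a M → ¬ ¬ Null T M)
  ¬Small⊆Null {T} dec inf null = null 1 (transversal T) (transversal-small T) λ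
    -- The depth at which the transversal is null is the depth of the diagonal.
    { (d , n) → diagonal-small d dec λ small → null (suc d) (diagonal d T) small
        (diagonal-positive d dec inf (AlmostAll-map d T (transversal-finite⇒Bounded T) n)) }

theorem4p6 : (X : Family) → IsPartitionFamily X → IndependentFamily X →
    ¬ (Σ (ℕ ⤖ SumDom) λ f →
    ∀ (A : Subset SumDom) → Finω A → Fin'ω X (λ m → A (Bijection.to f m)))
theorem4p6 X _ independent (bijection , reduces) =
  ¬Small⊆Null f dec (intersections-infinite X independent) λ a M small →
  -- The image of `M` is pulled back; its preimage contains `M`.
  Fin'ω-null X (reduces (λ z → ∃ λ m → f m ≡ z × M m) (Small⇒Finω f a small)) >>= λ null →
  return (mono (Null-ideal dec) (λ m p → return (m , refl , p)) null)
  where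
  f   = Bijection.to bijection
  dec = blocks-decreasing X 0 0 (X 0)
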